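{- The $(q,r)$-Whitney-Lah numbers $L_{m,r}[n,k]_q$ satisfy the horizontal recurrence relation $$L_{m,r}[n,k]_q=\sum_{j=0}^{n-k}(-1)^j\,q^{ -2r-m(k+j)-nm}\,\frac{r_{k+j+1,q}}{r_{k+1,q}}\,L_{m,r}[n+1,k+j+1]_q,$$ where $$r_{i,q}=\prod_{h=1}^{i-1}q^{ -2r-mh-nm+m}[mh+2r+nm]_q,$$ with initial value $L_{m,r}[0,0]_q=1$.
   Context: Here $q,m,r$ are parameters, and $[x]_q=\frac{q^x-1}{q-1}$, so that $[t-k]_q=\frac{1}{q^k}([t]_q-[k]_q)$. The $(q,r)$-Whitney-Lah numbers are defined by $$L_{m,r}[n,k]_q=q^{2r+m(k-1)+m(n-1)}L_{m,r}[n-1,k-1]_q+[2r+km+(n-1)m]_q\,L_{m,r}[n-1,k]_q,$$ with $L_{m,r}[n,k]_q=0$ if $n<k$ or $n,k<0$, and $L_{m,r}[n,k]_q=1$ if $n=k$ and $n\ge 0$.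
   Formalization: The convention L[n,n]=1 for all n≥0 contradicts the defining recurrence (which gives L[1,1]=q^{2r}) and makes the claim false at k=n; here only L[0,0]=1 is kept and the recurrence is applied for all n≥1, k≥0. -}

module Defs where

open import Level using (Level; _⊔_)
open import Algebra.Bundles using (CommutativeRing)
open import Algebra.Apartness.Bundles using (HeytingField; HeytingCommutativeRing)
open import Algebra.Morphism.Structures using (module MonoidMorphisms)
open import Data.Fin.Base using (toℕ)
open import Data.Nat.Base as ℕ using (ℕ; zero; suc; _∸_; _<_; z≤n; s≤s)
open import Data.Nat.Properties using (m<n⇒m<1+n)
open import Data.Product.Base using (_,_; proj₁)
import Algebra.Apartness.Properties.HeytingCommutativeRing
import Algebra.Definitions.RawMonoid
import Algebra.Properties.CommutativeMonoid.Sum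
import Algebra.Properties.Semiring.Exp

-- A meaning for qˣ with x ranging over a commutative ring E of exponents, so
-- that m and r need not be integers.  Examples: E = ℤ with any q # 0;
-- E = F = ℝ or ℂ with qˣ = exp (x log q); F = K(q) with E = ℤ.
-- The laws force q to be invertible.
record Powers {c ℓ₁ ℓ₂ a ℓ : Level}
              (F : HeytingField c ℓ₁ ℓ₂) (E : CommutativeRing a ℓ)
              (q : HeytingField.Carrier F) : Set (c ⊔ ℓ₁ ⊔ a ⊔ ℓ) where
  private
    module F = HeytingField F
    module F′ = CommutativeRing
      (HeytingCommutativeRing.commutativeRing F.heytingCommutativeRing)
    module E = CommutativeRing E
  field
    pow      : E.Carrier → F.Carrier
    pow-homo : MonoidMorphisms.IsMonoidHomomorphism
                 E.+-rawMonoid F′.*-rawMonoid pow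
    pow-1    : pow E.1# F.≈ q

module WhitneyLah
  {c ℓ₁ ℓ₂ a ℓ : Level}
  (F : HeytingField c ℓ₁ ℓ₂) (E : CommutativeRing a ℓ)
  (q : HeytingField.Carrier F)
  (q#1 : HeytingField._#_ F q (HeytingField.1# F))
  (P : Powers F E q)
  (m r : CommutativeRing.Carrier E)
  where

  open HeytingField F public
    using (Carrier; _≈_; _#_; _+_; _*_; -_; _-_; 0#; 1#; #⇒invertible)

  private
    HCR : HeytingCommutativeRing c ℓ₁ ℓ₂
    HCR = HeytingField.heytingCommutativeRing F

    R : CommutativeRing c ℓ₁
    R = HeytingCommutativeRing.commutativeRing HCR

    module R = CommutativeRing R
    module HP = Algebra.Apartness.Properties.HeytingCommutativeRing HCR

  open CommutativeRing E public using ()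
    renaming (_+_ to infixl 6 _⊕_; _-_ to infixl 6 _⊖_; -_ to infix 8 ⊖_)

  -- k · x is the k-fold sum x ⊕ ⋯ ⊕ x of an exponent.
  open Algebra.Definitions.RawMonoid (CommutativeRing.+-rawMonoid E) public
    using () renaming (_×_ to infixr 8 _·_)

  open Algebra.Properties.Semiring.Exp R.semiring public using (_^_)

  open Algebra.Properties.CommutativeMonoid.Sum R.+-commutativeMonoid public
    using (sum⁺-syntax)

  open Algebra.Properties.CommutativeMonoid.Sum R.*-commutativeMonoid
    using () renaming (sum to product)

  infix 9 q^_
  q^_ : CommutativeRing.Carrier E → Carrier
  q^_ = Powers.pow P

  -- The inverse supplied by y # 0# is that of y - 0#.
  infixl 7 _/_⟨_⟩
  _/_⟨_⟩ : (x y : Carrier) → y # 0# → Carrier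
  x / y ⟨ y#0 ⟩ = x * proj₁ (#⇒invertible y#0)

  q-1#0 : q - 1# # 0#
  q-1#0 with #⇒invertible q#1
  ... | u , u*[q-1]≈1 , _ =
    HP.invertibleˡ⇒# (u , R.trans (R.*-congˡ (HP.x-0≈x (q - 1#))) u*[q-1]≈1)

  [_]q : CommutativeRing.Carrier E → Carrier
  [ x ]q = (q^ x - 1#) / (q - 1#) ⟨ q-1#0 ⟩

  -- The recurrence is applied for every n ≥ 1 and every k ≥ 0, starting from
  -- L[0,0] = 1 and with L[n,-1] = 0 and L[0,k] = 0 for k > 0.  In particular it
  -- is applied at k = n, giving L[n,n] = q^(2rn + mn(n-1)).  Setting L[n,n] = 1
  -- for all n instead would contradict the recurrence at k = n, and also the
  -- k = n case of the horizontal recurrence.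
  L : ℕ → ℕ → Carrier
  L zero    zero    = 1#
  L zero    (suc k) = 0#
  L (suc n) zero    = [ 2 · r ⊕ 0 · m ⊕ n · m ]q * L n zero
  L (suc n) (suc k) = q^ (2 · r ⊕ k · m ⊕ n · m) * L n k
                    + [ 2 · r ⊕ suc k · m ⊕ n · m ]q * L n (suc k)

  n<k⇒L≈0 : ∀ {n k} → n < k → L n k ≈ 0#
  n<k⇒L≈0 {zero}  {suc k} _         = R.refl
  n<k⇒L≈0 {suc n} {suc k} (s≤s n<k) = R.trans
    (R.+-cong (R.trans (R.*-congˡ (n<k⇒L≈0 n<k)) (R.zeroʳ _))
              (R.trans (R.*-congˡ (n<k⇒L≈0 (m<n⇒m<1+n n<k))) (R.zeroʳ _)))
    (R.+-identityˡ 0#)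

  -- ρ n i is r_{i,q}, whose dependence on n the notation suppresses:
  -- the product over h = 1, …, i-1, with h = suc (toℕ h′).
  ρ : ℕ → ℕ → Carrier
  ρ n i = product {i ∸ 1} λ h′ → let h = suc (toℕ h′) in
    q^ (⊖ (2 · r) ⊖ h · m ⊖ n · m ⊕ m) * [ h · m ⊕ 2 · r ⊕ n · m ]q

{-# OPTIONS --safe #-}

-- Put Q_i = q^(2r+im+nm) and B_i = [2r+im+nm].  Multiplying
--   L[n+1,i+1] = Q_i L[n,i] + B_{i+1} L[n,i+1]
-- by r_{i+1}/Q_i, and using r_{i+2} = r_{i+1} B_{i+1}/Q_i, gives
--   r_{i+1}/Q_i L[n+1,i+1] = r_{i+1} L[n,i] + r_{i+2} L[n,i+1].
-- So the alternating sum over i = k, …, n telescopes to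
-- r_{k+1} L[n,k] ± r_{n+2} L[n,n+1], whose last term vanishes.
module Submission where

open import Defs
open import Level using (Level)
open import Algebra.Bundles using (CommutativeRing)
open import Algebra.Apartness.Bundles using (HeytingField; HeytingCommutativeRing)
open import Algebra.Morphism.Structures using (module MonoidMorphisms)
open import Data.Fin.Base using (Fin; toℕ; inject₁; fromℕ)
open import Data.Fin.Properties using (toℕ-inject₁; toℕ-fromℕ)
open import Data.Nat.Base as ℕ using (ℕ; zero; suc; _∸_; _≤_)
open import Data.Nat.Properties as ℕ using (m+[n∸m]≡n)
open import Data.Product.Base using (_×_; _,_; proj₁; proj₂)
open import Function.Base using (_∘_)
open import Relation.Binary.PropositionalEquality as ≡ using (cong)
import Algebra.Apartness.Properties.HeytingCommutativeRing as HeytingProperties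
import Algebra.Properties.AbelianGroup as AbelianGroupProperties
import Algebra.Properties.CommutativeSemigroup as CommutativeSemigroupProperties
import Algebra.Properties.Monoid.Sum as MonoidSum
import Algebra.Properties.Ring as RingProperties
import Algebra.Properties.Semiring.Exp as SemiringExp
import Algebra.Properties.Semiring.Sum as SemiringSum
import Relation.Binary.Reasoning.Setoid as SetoidReasoning

module AlternatingSum {c ℓ : Level} (R : CommutativeRing c ℓ) where
  open CommutativeRing R
  open RingProperties ring using (-1*x≈-x)
  open SemiringExp semiring using (_^_)
  open SemiringSum semiring
  open SetoidReasoning setoid

  -- Induction on `d` with `a` and `t` general: the induction hypothesis for both sequences shifted
  -- by one expands `a 1`, and `a 0` is `t 0` minus that. The assumption on `a (suc d)` removes the
  -- boundary term.
  alternating-sum-telescopes :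
    (a t : ℕ → Carrier) → (∀ i → t i ≈ a i + a (suc i)) →
    ∀ d → a (suc d) ≈ 0# → a 0 ≈ ∑[ j ≤ d ] ((- 1#) ^ toℕ j * t (toℕ j))
  alternating-sum-telescopes a t t≈a+a zero a₁≈0 = begin
    a 0               ≈⟨ +-identityʳ _ ⟨
    a 0 + 0#          ≈⟨ +-congˡ a₁≈0 ⟨
    a 0 + a 1         ≈⟨ t≈a+a 0 ⟨
    t 0               ≈⟨ *-identityˡ _ ⟨
    1# * t 0          ≈⟨ +-identityʳ _ ⟨
    1# * t 0 + 0#     ∎
  alternating-sum-telescopes a t t≈a+a (suc d) a≈0 = begin
    a 0                                  ≈⟨ +-identityʳ _ ⟨
    a 0 + 0#                             ≈⟨ +-congˡ (-‿inverseʳ _) ⟨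
    a 0 + (a 1 - a 1)                    ≈⟨ +-assoc _ _ _ ⟨
    a 0 + a 1 - a 1                      ≈⟨ +-cong (t≈a+a 0) (-1*x≈-x _) ⟨
    t 0 + - 1# * a 1                     ≈⟨ +-cong (sym (*-identityˡ _)) (*-congˡ a₁≈S) ⟩
    1# * t 0 + - 1# * S                  ≈⟨ +-congˡ (*-distribˡ-sum {n = suc d} (- 1#) s) ⟩
    1# * t 0 + ∑[ j ≤ d ] (- 1# * s j)
      -- After reassociation, `- 1# * (- 1#) ^ toℕ j` is `(- 1#) ^ suc (toℕ j)` by computation, so
      -- the outer minus sign shifts the exponent.
      ≈⟨ +-congˡ (sum-cong-≋ {n = suc d} (λ j →
           sym (*-assoc (- 1#) ((- 1#) ^ toℕ j) (t (suc (toℕ j)))))) ⟩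
    1# * t 0 + ∑[ j ≤ d ] ((- 1#) ^ suc (toℕ j) * t (suc (toℕ j)))  ∎
    where
    s : Fin (suc d) → Carrier
    s j = (- 1#) ^ toℕ j * t (suc (toℕ j))

    S = ∑[ j ≤ d ] s j

    a₁≈S : a 1 ≈ S
    a₁≈S = alternating-sum-telescopes (a ∘ suc) (t ∘ suc) (t≈a+a ∘ suc) d a≈0

module HorizontalRecurrence
  {c ℓ₁ ℓ₂ a ℓ : Level}
  (F : HeytingField c ℓ₁ ℓ₂) (E : CommutativeRing a ℓ)
  (q : HeytingField.Carrier F)
  (q#1 : HeytingField._#_ F q (HeytingField.1# F))
  (P : Powers F E q)
  (m r : CommutativeRing.Carrier E)
  where

  open WhitneyLah F E q q#1 P m r

  private
    HCR = HeytingField.heytingCommutativeRing F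
    R = HeytingCommutativeRing.commutativeRing HCR
    module R = CommutativeRing R
    module E where
      open CommutativeRing E public
      open AbelianGroupProperties +-abelianGroup public using (⁻¹-∙-comm)
      open CommutativeSemigroupProperties +-commutativeSemigroup public
        using (x∙yz≈y∙xz)
    module Pow = MonoidMorphisms.IsMonoidHomomorphism (Powers.pow-homo P)

  open HeytingProperties HCR using (x-0≈x)
  open CommutativeSemigroupProperties R.*-commutativeSemigroup
    using (interchange; xy∙z≈xz∙y)
  open AlternatingSum R

  ⊖-⊖-⊖≈⊖[⊕⊕] : ∀ x y z → ⊖ x ⊖ y ⊖ z E.≈ ⊖ (x ⊕ y ⊕ z)
  ⊖-⊖-⊖≈⊖[⊕⊕] x y z = E.trans (E.+-congʳ (E.⁻¹-∙-comm x y)) (E.⁻¹-∙-comm (x ⊕ y) z)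

  -- Used with `w = m` and `w ⊕ y = suc i · m`: the trailing `⊕ m` in the exponents of `ρ` lowers
  -- the index by one, so that the factor at h = i+1 carries 1/Q_i and not 1/Q_{i+1}.
  ⊖x⊖[w⊕y]⊖z⊕w≈⊖x⊖y⊖z : ∀ w x y z → ⊖ x ⊖ (w ⊕ y) ⊖ z ⊕ w E.≈ ⊖ x ⊖ y ⊖ z
  ⊖x⊖[w⊕y]⊖z⊕w≈⊖x⊖y⊖z w x y z = begin
    ⊖ x ⊖ (w ⊕ y) ⊖ z ⊕ w       ≈⟨ E.+-congʳ (⊖-⊖-⊖≈⊖[⊕⊕] x (w ⊕ y) z) ⟩
    ⊖ (x ⊕ (w ⊕ y) ⊕ z) ⊕ w     ≈⟨ E.+-congʳ (E.-‿cong (E.+-congʳ (E.x∙yz≈y∙xz x w y))) ⟩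
    ⊖ (w ⊕ (x ⊕ y) ⊕ z) ⊕ w     ≈⟨ E.+-congʳ (E.-‿cong (E.trans (E.+-assoc _ _ _) (E.+-comm _ _))) ⟩
    ⊖ (x ⊕ y ⊕ z ⊕ w) ⊕ w       ≈⟨ E.+-congʳ (E.⁻¹-∙-comm _ w) ⟨
    ⊖ (x ⊕ y ⊕ z) ⊖ w ⊕ w       ≈⟨ E.+-assoc _ _ _ ⟩
    ⊖ (x ⊕ y ⊕ z) ⊕ (⊖ w ⊕ w)   ≈⟨ E.+-congˡ (E.-‿inverseˡ w) ⟩
    ⊖ (x ⊕ y ⊕ z) ⊕ E.0#        ≈⟨ E.+-identityʳ _ ⟩
    ⊖ (x ⊕ y ⊕ z)               ≈⟨ ⊖-⊖-⊖≈⊖[⊕⊕] x y z ⟨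
    ⊖ x ⊖ y ⊖ z                 ∎
    where open SetoidReasoning E.setoid

  open SetoidReasoning R.setoid

  q^[⊖x⊖y⊖z]*q^[x⊕y⊕z]≈1 : ∀ x y z → q^ (⊖ x ⊖ y ⊖ z) * q^ (x ⊕ y ⊕ z) ≈ 1#
  q^[⊖x⊖y⊖z]*q^[x⊕y⊕z]≈1 x y z = begin
    q^ (⊖ x ⊖ y ⊖ z) * q^ (x ⊕ y ⊕ z)   ≈⟨ Pow.homo _ _ ⟨
    q^ (⊖ x ⊖ y ⊖ z ⊕ (x ⊕ y ⊕ z))      ≈⟨ Pow.⟦⟧-cong (E.+-congʳ (⊖-⊖-⊖≈⊖[⊕⊕] x y z)) ⟩
    q^ (⊖ (x ⊕ y ⊕ z) ⊕ (x ⊕ y ⊕ z))    ≈⟨ Pow.⟦⟧-cong (E.-‿inverseˡ _) ⟩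
    q^ E.0#                             ≈⟨ Pow.ε-homo ⟩
    1#                                  ∎

  []q-cong : ∀ {x y} → x E.≈ y → [ x ]q ≈ [ y ]q
  []q-cong x≈y = R.*-congʳ (R.+-congʳ (Pow.⟦⟧-cong x≈y))

  x/x≈1 : ∀ {x} (x#0 : x # 0#) → x / x ⟨ x#0 ⟩ ≈ 1#
  x/x≈1 {x} x#0 =
    R.trans (R.*-congʳ (R.sym (x-0≈x x))) (proj₂ (proj₂ (#⇒invertible x#0)))

  ρ-suc : ∀ n i → ρ n (suc (suc i)) ≈
    ρ n (suc i) * (q^ (⊖ (2 · r) ⊖ i · m ⊖ n · m) * [ 2 · r ⊕ suc i · m ⊕ n · m ]q)
  ρ-suc n i = begin
    ρ n (suc (suc i))
      -- `sum` is that of the multiplicative monoid, hence a product. It unfolds from its first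
      -- factor, whereas the new factor, h = i+1, is the last.
      ≈⟨ sum-init-last {n = i} (factor ∘ toℕ) ⟩
    sum (λ j → factor (toℕ (inject₁ {i} j))) * factor (toℕ (fromℕ i))
      ≡⟨ ≡.cong₂ _*_ (sum-cong-≗ {n = i} (cong factor ∘ toℕ-inject₁)) (cong factor (toℕ-fromℕ i)) ⟩
    ρ n (suc i) * factor i
      ≈⟨ R.*-congˡ (R.*-cong
           (Pow.⟦⟧-cong (⊖x⊖[w⊕y]⊖z⊕w≈⊖x⊖y⊖z m (2 · r) (i · m) (n · m)))
           ([]q-cong (E.+-congʳ (E.+-comm (suc i · m) (2 · r))))) ⟩
    ρ n (suc i) * (q^ (⊖ (2 · r) ⊖ i · m ⊖ n · m) * [ 2 · r ⊕ suc i · m ⊕ n · m ]q) ∎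
    where
    open MonoidSum R.*-monoid using (sum; sum-init-last; sum-cong-≗)

    factor : ℕ → Carrier
    factor h = q^ (⊖ (2 · r) ⊖ suc h · m ⊖ n · m ⊕ m) * [ suc h · m ⊕ 2 · r ⊕ n · m ]q

  -- With u = 1 / r_{k+1} the quotients r_{i+1} / r_{k+1} appear.
  scaled-recurrence : ∀ n u i →
    q^ (⊖ (2 · r) ⊖ i · m ⊖ n · m) * (ρ n (i ℕ.+ 1) * u) * L (n ℕ.+ 1) (i ℕ.+ 1)
    ≈ ρ n (i ℕ.+ 1) * u * L n i + ρ n (suc i ℕ.+ 1) * u * L n (suc i)
  -- With `suc` in front, `L` unfolds by its defining recurrence.
  scaled-recurrence n u i rewrite ℕ.+-comm i 1 | ℕ.+-comm n 1 = begin
    e * (ρ₁ * u) * (Q * L n i + B * L n (suc i))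
      ≈⟨ R.distribˡ _ _ _ ⟩
    e * (ρ₁ * u) * (Q * L n i) + e * (ρ₁ * u) * (B * L n (suc i))
      ≈⟨ R.+-cong (interchange _ _ _ _) (R.sym (R.*-assoc _ _ _)) ⟩
    e * Q * (ρ₁ * u * L n i) + e * (ρ₁ * u) * B * L n (suc i)
      -- The first summand loses `e * Q`; in the second, `e * B` is collected because it is exactly
      -- the factor added by `ρ-suc`.
      ≈⟨ R.+-cong
           (R.*-congʳ (q^[⊖x⊖y⊖z]*q^[x⊕y⊕z]≈1 (2 · r) (i · m) (n · m)))
           (R.*-congʳ (xy∙z≈xz∙y _ _ _)) ⟩
    1# * (ρ₁ * u * L n i) + e * B * (ρ₁ * u) * L n (suc i)
      ≈⟨ R.+-cong (R.*-identityˡ _) (R.*-congʳ (R.trans (R.*-comm _ _) (xy∙z≈xz∙y _ _ _))) ⟩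
    ρ₁ * u * L n i + ρ₁ * (e * B) * u * L n (suc i)
      ≈⟨ R.+-congˡ (R.*-congʳ (R.*-congʳ (ρ-suc n i))) ⟨
    ρ₁ * u * L n i + ρ n (suc (suc i)) * u * L n (suc i) ∎
    where
    e  = q^ (⊖ (2 · r) ⊖ i · m ⊖ n · m)
    Q  = q^ (2 · r ⊕ i · m ⊕ n · m)
    B  = [ 2 · r ⊕ suc i · m ⊕ n · m ]q
    ρ₁ = ρ n (suc i)

  horizontal-recurrence : ∀ n k → k ≤ n → (ρ#0 : ρ n (k ℕ.+ 1) # 0#) →
    L n k ≈ ∑[ j ≤ n ∸ k ]
      ((- 1#) ^ toℕ j
        * q^ (⊖ (2 · r) ⊖ (k ℕ.+ toℕ j) · m ⊖ n · m)
        * (ρ n (k ℕ.+ toℕ j ℕ.+ 1) / ρ n (k ℕ.+ 1) ⟨ ρ#0 ⟩)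
        * L (n ℕ.+ 1) (k ℕ.+ toℕ j ℕ.+ 1))
  horizontal-recurrence n k k≤n ρ#0 = begin
    L n k                              ≈⟨ R.*-identityˡ _ ⟨
    1# * L n k                         ≈⟨ R.*-congʳ (x/x≈1 ρ#0) ⟨
    -- The telescoping sequences are shifted by `k`, so they start at `k ℕ.+ 0`.
    α k                                ≡⟨ cong α (ℕ.+-identityʳ k) ⟨
    α (k ℕ.+ 0)
      ≈⟨ alternating-sum-telescopes (α ∘ (k ℕ.+_)) (τ ∘ (k ℕ.+_)) τ≈α+α (n ∸ k) αₙ₊₁≈0 ⟩
    ∑[ j ≤ n ∸ k ] ((- 1#) ^ toℕ j * τ (k ℕ.+ toℕ j))
      ≈⟨ sum-cong-≋ {n = suc (n ∸ k)} (λ j →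
           x∙yzw≈xyz∙w ((- 1#) ^ toℕ j) (e (k ℕ.+ toℕ j)) (β (k ℕ.+ toℕ j)) (l (k ℕ.+ toℕ j))) ⟩
    ∑[ j ≤ n ∸ k ]
      ((- 1#) ^ toℕ j * e (k ℕ.+ toℕ j) * β (k ℕ.+ toℕ j) * l (k ℕ.+ toℕ j)) ∎
    where
    open MonoidSum R.+-monoid using (sum-cong-≋)

    -- This is the inverse inside `_/_⟨_⟩`, so `β i` is by definition the quotient r_{i+1}/r_{k+1}
    -- of the statement, and `β k` is 1.
    u = proj₁ (#⇒invertible ρ#0)

    e β l α τ : ℕ → Carrier
    e i  = q^ (⊖ (2 · r) ⊖ i · m ⊖ n · m)
    β i  = ρ n (i ℕ.+ 1) * u
    l i  = L (n ℕ.+ 1) (i ℕ.+ 1)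
    α i  = β i * L n i
    τ i  = e i * β i * l i

    x∙yzw≈xyz∙w : ∀ x y z w → x * (y * z * w) ≈ x * y * z * w
    x∙yzw≈xyz∙w x y z w =
      R.trans (R.sym (R.*-assoc x (y * z) w)) (R.*-congʳ (R.sym (R.*-assoc x y z)))

    τ≈α+α : ∀ j → τ (k ℕ.+ j) ≈ α (k ℕ.+ j) + α (k ℕ.+ suc j)
    τ≈α+α j rewrite ℕ.+-suc k j = scaled-recurrence n u (k ℕ.+ j)

    αₙ₊₁≈0 : α (k ℕ.+ suc (n ∸ k)) ≈ 0#
    -- As `k ≤ n`, the index becomes `suc n`, one step past the diagonal, where `L n` vanishes.
    αₙ₊₁≈0 rewrite ℕ.+-suc k (n ∸ k) | m+[n∸m]≡n k≤n =
      R.trans (R.*-congˡ (n<k⇒L≈0 (ℕ.n<1+n n))) (R.zeroʳ _)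

theorem2p5 : ∀ {c ℓ₁ ℓ₂ a ℓ : Level}
    (F : HeytingField c ℓ₁ ℓ₂) (E : CommutativeRing a ℓ)
    (q : HeytingField.Carrier F)
    (q#1 : HeytingField._#_ F q (HeytingField.1# F))
    (P : Powers F E q)
    (m r : CommutativeRing.Carrier E) →
    let open WhitneyLah F E q q#1 P m r in
    (L 0 0 ≈ 1#) ×
    (∀ (n k : ℕ) → k ≤ n → (ρ#0 : ρ n (k ℕ.+ 1) # 0#) →
      L n k ≈ ∑[ j ≤ n ∸ k ]
        ((- 1#) ^ toℕ j
          * q^ (⊖ (2 · r) ⊖ (k ℕ.+ toℕ j) · m ⊖ n · m)
          * (ρ n (k ℕ.+ toℕ j ℕ.+ 1) / ρ n (k ℕ.+ 1) ⟨ ρ#0 ⟩)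
          * L (n ℕ.+ 1) (k ℕ.+ toℕ j ℕ.+ 1)))
theorem2p5 F E q q#1 P m r = HeytingField.refl F , horizontal-recurrence
  where open HorizontalRecurrence F E q q#1 P m r
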